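{- For every weakly guarded recursive specification $\Gamma$ over $\mathrm{BPP}^{\mathbf{0}\mathbf{1}}$ (with finitely many process identifiers and a designated initial identifier) there is a parallel pushdown automaton $M$ such that the process graph of $\Gamma$ is divergence-preserving branching bisimilar to the process graph $\mathcal{P}(M)$ of $M$.
   Context: **Labelled transition systems and process graphs.** A labelled transition system is a tuple $(\mathcal{S},\mathcal{A},\rightarrow,\downarrow)$ with $\mathcal{S}$ a set of states, $\mathcal{A}$ a set of actions, $\tau\notin\mathcal{A}$ the silent action, $\rightarrow\,\subseteq\mathcal{S}\times(\mathcal{A}\cup\{\tau\})\times\mathcal{S}$ the transition relation, and $\downarrow\,\subseteq\mathcal{S}$ the set of accepting (final) states; write $s\xrightarrow{a}s'$ and $s\downarrow$. A process graph is a labelled transition system with a designated root state. Write $s\Rightarrow t$ if $t$ can be reached from $s$ by zero or more $\tau$-transitions, $s\Rightarrow^{+}t$ if by one or more, and $s\xrightarrow{(a)}t$ if $s\xrightarrow{a}t$, or $a=\tau$ and $s=t$. **Divergence-preserving branching bisimilarity.** A symmetric relation $R$ on $\mathcal{S}$ is a branching bisimulation if for all $s\mathrel{R}t$ and $a\in\mathcal{A}\cup\{\tau\}$: (1) if $s\xrightarrow{a}s'$ then there are $t'',t'$ with $t\Rightarrow t''\xrightarrow{(a)}t'$, $s\mathrel{R}t''$ and $s'\mathrel{R}t'$; (2) if $s\downarrow$ then there is $t'$ with $t\Rightarrow t'$ and $t'\downarrow$. It is divergence-preserving if for all $s,t$, whenever there is an infinite sequence $s=s_0\xrightarrow{\tau}s_1\xrightarrow{\tau}s_2\cdots$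 with $s_i\mathrel{R}t$ for all $i\geq 0$, there is $t'$ with $t\Rightarrow^{+}t'$ and $s_i\mathrel{R}t'$ for some $i\geq 0$. States $s,t$ are divergence-preserving branching bisimilar if some divergence-preserving branching bisimulation relates them. Two process graphs are divergence-preserving branching bisimilar if their roots are, in the disjoint union of the two underlying labelled transition systems. **Parallel pushdown automata.** $\mathcal{D}^{\{\!\{\,\}\!\}}$ is the set of finite multisets (bags) over $\mathcal{D}$, $\cup$ on bags is multiset sum, and $\mathcal{D}^{\pm}=\{+d\mid d\in\mathcal{D}\}\cup\{ -d\mid d\in\mathcal{D}\}$ (two disjoint copies of $\mathcal{D}$). A parallel pushdown automaton is a tuple $M=(\mathcal{S},\mathcal{A},\mathcal{D},\rightarrow,\uparrow,\downarrow)$ with $\mathcal{S}$ a finite set of states, $\mathcal{A}$ a finite input alphabet ($\tau\notin\mathcal{A}$), $\mathcal{D}$ a finite data alphabet, $\rightarrow\,\subseteq\mathcal{S}\times(\mathcal{A}\cup\{\tau\})\times\mathcal{D}^{\pm}\times\mathcal{D}^{\{\!\{\,\}\!\}}\times\mathcal{S}$ a finite set of transitions, $\uparrow\,\in\mathcal{S}$ the initial state, and $\downarrow\,\subseteq\mathcal{S}$ the accepting states. Write $s\xrightarrow{a[+d/x]}t$ for $(s,a,+d,x,t)\in\,\rightarrow$, and $s\xrightarrow{a[-d/x]}t$ for $(s,a,-d,x,t)\in\,\rightarrow$. The process graph $\mathcal{P}(M)$ has states $(s,x)$ with $s\in\mathcal{S}$, $x\in\mathcal{D}^{\{\!\{\,\}\!\}}$;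 root $(\uparrow,\emptyset)$; accepting states all $(s,x)$ with $s\in\,\downarrow$; and exactly the transitions $(s,\{\!\{d\}\!\}\cup x)\xrightarrow{a}(s',x'\cup x)$ whenever $s\xrightarrow{a[+d/x']}s'$, and $(s,x)\xrightarrow{a}(s',x'\cup x)$ whenever there is $d\notin x$ with $s\xrightarrow{a[-d/x']}s'$. **Process algebra $\mathrm{BPP}^{\mathbf{0}\mathbf{1}}$.** Let $\mathcal{A}$ be a set of actions, $\tau\notin\mathcal{A}$ the silent action, and $\mathcal{P}$ a finite set of process identifiers. Process expressions are generated by $p::=\mathbf{0}\mid\mathbf{1}\mid a.p\mid p+p\mid p\parallel p\mid X$ with $a\in\mathcal{A}\cup\{\tau\}$, $X\in\mathcal{P}$. A recursive specification $\Gamma$ assigns to every $X\in\mathcal{P}$ exactly one defining equation $X\stackrel{\mathrm{def}}{=}p$ with $p$ a process expression. It is weakly guarded if every occurrence of a process identifier in the right-hand side of a defining equation is within the scope of an action prefix $a.\_$ with $a\in\mathcal{A}\cup\{\tau\}$. Relative to $\Gamma$, the transition relations $\xrightarrow{a}$ and acceptance predicate $\downarrow$ on process expressions are the least ones satisfying: $\mathbf{1}\downarrow$; $a.p\xrightarrow{a}p$; if $p\downarrow$ or $q\downarrow$ then $(p+q)\downarrow$; if $p\xrightarrow{a}p'$ then $p+q\xrightarrow{a}p'$ and $q+p\xrightarrow{a}p'$; if $p\downarrow$ and $q\downarrow$ then $(p\parallel q)\downarrow$; if $p\xrightarrow{a}p'$ then $p\parallel q\xrightarrow{a}p'\parallel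 q$ and $q\parallel p\xrightarrow{a}q\parallel p'$; if $X\stackrel{\mathrm{def}}{=}p$ and $p\xrightarrow{a}p'$ then $X\xrightarrow{a}p'$; if $X\stackrel{\mathrm{def}}{=}p$ and $p\downarrow$ then $X\downarrow$. The process graph of $\Gamma$ is this labelled transition system with the initial identifier as root. -}

module Defs where

open import Data.Fin.Base using (Fin)
open import Data.Fin.Subset using (Subset) renaming (_∈_ to _∈ˢ_)
open import Data.List.Base using (List)
open import Data.List.Membership.Propositional using (_∈_)
open import Data.Nat.Base using (ℕ; suc; _+_)
open import Data.Product.Base using (_×_; _,_; ∃-syntax)
open import Data.Sum.Base using (_⊎_; inj₁; inj₂; [_,_])
open import Data.Sum.Relation.Binary.Pointwise using (Pointwise)
open import Data.Vec.Base using (Vec; lookup; replicate; zipWith; _[_]≔_)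
open import Relation.Binary.Construct.Closure.ReflexiveTransitive using (Star)
open import Relation.Binary.Construct.Closure.Transitive using (TransClosure)
open import Relation.Binary.Core using (Rel)
open import Relation.Binary.Definitions using (Symmetric)
open import Relation.Binary.PropositionalEquality.Core using (_≡_)

data Label (A : Set) : Set where
  τ   : Label A
  act : A → Label A

record LTS (A : Set) : Set₁ where
  field
    State    : Set
    _—[_]→_  : State → Label A → State → Set
    _↓       : State → Set

  _⇒_ : State → State → Set
  _⇒_ = Star (λ s t → s —[ τ ]→ t)

  _⇒⁺_ : State → State → Set
  _⇒⁺_ = TransClosure (λ s t → s —[ τ ]→ t)

  _—⟨_⟩→_ : State → Label A → State → Set
  s —⟨ a ⟩→ t = s —[ a ]→ t ⊎ (a ≡ τ × s ≡ t)

record ProcessGraph (A : Set) : Set₁ where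
  field
    lts  : LTS A
    root : LTS.State lts

_⊎ˡ_ : {A : Set} → LTS A → LTS A → LTS A
L ⊎ˡ K = record
  { State    = L.State ⊎ K.State
  ; _—[_]→_  = λ s a t → Pointwise (L._—[ a ]→_) (K._—[ a ]→_) s t
  ; _↓       = [ L._↓ , K._↓ ]
  }
  where
  module L = LTS L
  module K = LTS K

module Bisimulation {A : Set} (L : LTS A) where
  open LTS L

  record IsBranchingBisimulation (R : State → State → Set) : Set where
    field
      symmetric : Symmetric R
      transfer  : ∀ {s t} → R s t → ∀ {a s′} → s —[ a ]→ s′ →
                  ∃[ t″ ] ∃[ t′ ] (t ⇒ t″ × t″ —⟨ a ⟩→ t′ × R s t″ × R s′ t′)
      accept    : ∀ {s t} → R s t → s ↓ → ∃[ t′ ] (t ⇒ t′ × t′ ↓)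

  DivergencePreserving : (State → State → Set) → Set
  DivergencePreserving R =
    ∀ (s : ℕ → State) (t : State) →
    (∀ i → s i —[ τ ]→ s (suc i)) →
    (∀ i → R (s i) t) →
    ∃[ t′ ] (t ⇒⁺ t′ × ∃[ i ] R (s i) t′)

  Bisimilar : State → State → Set₁
  Bisimilar s t =
    ∃[ R ] (IsBranchingBisimulation R × DivergencePreserving R × R s t)

_≈ᵇΔ_ : {A : Set} → ProcessGraph A → ProcessGraph A → Set₁
G ≈ᵇΔ H = Bisimulation.Bisimilar (G.lts ⊎ˡ H.lts) (inj₁ G.root) (inj₂ H.root)
  where
  module G = ProcessGraph G
  module H = ProcessGraph H

-- A finite multiset over Fin m is its vector of multiplicities, so that
-- equality of multisets is propositional equality.
Bag : ℕ → Set
Bag m = Vec ℕ m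

module _ {m : ℕ} where

  ∅ : Bag m
  ∅ = replicate m 0

  ⟅_⟆ : Fin m → Bag m
  ⟅ d ⟆ = ∅ [ d ]≔ 1

  _∪_ : Bag m → Bag m → Bag m
  _∪_ = zipWith _+_

  _∉_ : Fin m → Bag m → Set
  d ∉ x = lookup x d ≡ 0

data Signed (D : Set) : Set where
  +ˢ_ : D → Signed D
  -ˢ_ : D → Signed D

-- A is the ambient set of actions.  The finite input alphabet is a finite
-- subset of A, so that automata with different alphabets have process
-- graphs over the same set of labels.
record PPDA (A : Set) : Set where
  field
    #states     : ℕ
    #data       : ℕ
    alphabet    : List A
    transitions : List (Fin #states × Label A × Signed (Fin #data)
                          × Bag #data × Fin #states)
    labels⊆     : ∀ {s a δ x t} →
                  (s , act a , δ , x , t) ∈ transitions → a ∈ alphabet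
    initial     : Fin #states
    accepting   : Subset #states

  Config : Set
  Config = Fin #states × Bag #data

  data Step : Config → Label A → Config → Set where
    present : ∀ {s a d x′ s′ x} → (s , a , +ˢ d , x′ , s′) ∈ transitions →
              Step (s , ⟅ d ⟆ ∪ x) a (s′ , x′ ∪ x)
    absent  : ∀ {s a d x′ s′ x} → (s , a , -ˢ d , x′ , s′) ∈ transitions →
              d ∉ x → Step (s , x) a (s′ , x′ ∪ x)

𝒫 : {A : Set} → PPDA A → ProcessGraph A
𝒫 M = record
  { lts  = record
    { State    = Config
    ; _—[_]→_  = Step
    ; _↓       = λ (s , _) → s ∈ˢ accepting
    }
  ; root = initial , ∅
  }
  where open PPDA M

infixr 8 _·_
infixr 7 _∥_
infixr 6 _⊕_

data Expr (A : Set) (n : ℕ) : Set where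
  𝟎 𝟏 : Expr A n
  _·_ : Label A → Expr A n → Expr A n
  _⊕_ : Expr A n → Expr A n → Expr A n
  _∥_ : Expr A n → Expr A n → Expr A n
  var : Fin n → Expr A n

Specification : Set → ℕ → Set
Specification A n = Fin n → Expr A n

data Guarded {A : Set} {n : ℕ} : Expr A n → Set where
  𝟎   : Guarded 𝟎
  𝟏   : Guarded 𝟏
  _·_ : ∀ a p → Guarded (a · p)
  _⊕_ : ∀ {p q} → Guarded p → Guarded q → Guarded (p ⊕ q)
  _∥_ : ∀ {p q} → Guarded p → Guarded q → Guarded (p ∥ q)

WeaklyGuarded : {A : Set} {n : ℕ} → Specification A n → Set
WeaklyGuarded Γ = ∀ X → Guarded (Γ X)

module Semantics {A : Set} {n : ℕ} (Γ : Specification A n) where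

  data _↓ᵉ : Expr A n → Set where
    𝟏↓   : 𝟏 ↓ᵉ
    ⊕↓ˡ  : ∀ {p q} → p ↓ᵉ → (p ⊕ q) ↓ᵉ
    ⊕↓ʳ  : ∀ {p q} → q ↓ᵉ → (p ⊕ q) ↓ᵉ
    ∥↓   : ∀ {p q} → p ↓ᵉ → q ↓ᵉ → (p ∥ q) ↓ᵉ
    var↓ : ∀ {X} → Γ X ↓ᵉ → var X ↓ᵉ

  data _—[_]→ᵉ_ : Expr A n → Label A → Expr A n → Set where
    prefix : ∀ {a p} → (a · p) —[ a ]→ᵉ p
    ⊕ˡ     : ∀ {a p p′ q} → p —[ a ]→ᵉ p′ → (p ⊕ q) —[ a ]→ᵉ p′
    ⊕ʳ     : ∀ {a p p′ q} → p —[ a ]→ᵉ p′ → (q ⊕ p) —[ a ]→ᵉ p′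
    ∥ˡ     : ∀ {a p p′ q} → p —[ a ]→ᵉ p′ → (p ∥ q) —[ a ]→ᵉ (p′ ∥ q)
    ∥ʳ     : ∀ {a p p′ q} → p —[ a ]→ᵉ p′ → (q ∥ p) —[ a ]→ᵉ (q ∥ p′)
    unfold : ∀ {a X p′} → Γ X —[ a ]→ᵉ p′ → var X —[ a ]→ᵉ p′

processGraph : {A : Set} {n : ℕ} → Specification A n → Fin n → ProcessGraph A
processGraph {A} {n} Γ X₀ = record
  { lts  = record
    { State    = Expr A n
    ; _—[_]→_  = _—[_]→ᵉ_
    ; _↓       = _↓ᵉ
    }
  ; root = var X₀
  }
  where open Semantics Γ

{-# OPTIONS --safe #-}

-- The automaton keeps the parallel components of a process expression in its
-- bag: the data are the (finitely many) subexpressions of the specification,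
-- and a datum is replaced by the bag of its derivative whenever it moves.  An
-- expression accepts iff all its components do, which the finite control has to
-- discover: it runs through the non-accepting data, testing with inert
-- τ-transitions that each is absent, and accepts at the end of this chain; any
-- move of a component restarts the chain.  Divergence is preserved since
-- the tests strictly decrease the distance to the end of the chain.

module Submission where

open import Data.Empty using (⊥-elim)
open import Data.Fin.Base using (Fin; zero; suc; toℕ; fromℕ; inject₁)
open import Data.Fin.Induction using (>-weakInduction)
open import Data.Fin.Properties
  using (toℕ-inject₁; toℕ-fromℕ; toℕ<n; toℕ-injective)
open import Data.Fin.Subset using (⁅_⁆)
open import Data.Fin.Subset.Properties using (x∈⁅x⁆; x∈⁅y⁆⇒x≡y)
open import Data.List.Base as List
  using (List; []; _∷_; _++_; map; concatMap; allFin; tabulate; filter; cartesianProductWith)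
open import Data.List.Membership.Propositional using (_∈_; lose; find)
open import Data.List.Membership.Propositional.Properties
open import Data.List.Relation.Binary.Subset.Propositional using (_⊆_)
open import Data.List.Relation.Unary.Any using (here; there; index)
open import Data.List.Relation.Unary.Any.Properties using (lookup-index)
open import Data.Nat.Base using (ℕ; zero; suc; _+_; _∸_; _<_; s≤s; s≤s⁻¹)
open import Data.Nat.Properties
  using (+-assoc; +-comm; +-identityˡ; +-identityʳ; m+n≡0⇒m≡0; m+n≡0⇒n≡0; suc-injective;
         ∸-monoʳ-<; n<1+n; <-≤-trans; ≤-reflexive; m≤n⇒m<n∨m≡n)
open import Data.Product.Base using (_×_; _,_; ∃-syntax; proj₂)
open import Data.Sum.Base using (_⊎_; inj₁; inj₂; [_,_]′)
open import Data.Sum.Relation.Binary.Pointwise using (inj₁; inj₂)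
open import Data.Vec.Base using (_∷_; lookup)
open import Data.Vec.Properties
  using (zipWith-assoc; zipWith-comm; zipWith-identityˡ; zipWith-identityʳ; lookup-zipWith;
         lookup∘update; lookup∘update′; lookup-replicate; ∷-injective; ∷-injectiveˡ; ∷-injectiveʳ)
open import Function.Base using (_∘_; id; case_of_)
open import Relation.Binary.Construct.Closure.ReflexiveTransitive using (ε; _◅_; gmap)
open import Relation.Binary.Construct.Closure.Transitive using ([_]; _∷_)
open import Relation.Binary.PropositionalEquality
  using (_≡_; _≢_; refl; sym; trans; cong; cong₂; subst; module ≡-Reasoning)
open import Relation.Nullary using (Dec; yes; no; ¬_; ¬?)
open import Relation.Nullary.Decidable using (map′; _×-dec_; _⊎-dec_)
open import Defs

-- Algebra of finite bags.

module _ {m : ℕ} where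

  ∪-assoc : (x y z : Bag m) → (x ∪ y) ∪ z ≡ x ∪ (y ∪ z)
  ∪-assoc = zipWith-assoc +-assoc

  ∪-comm : (x y : Bag m) → x ∪ y ≡ y ∪ x
  ∪-comm = zipWith-comm +-comm

  ∪-identityˡ : (x : Bag m) → ∅ ∪ x ≡ x
  ∪-identityˡ = zipWith-identityˡ +-identityˡ

  ∪-identityʳ : (x : Bag m) → x ∪ ∅ ≡ x
  ∪-identityʳ = zipWith-identityʳ +-identityʳ

  ∪-leftComm : (x y z : Bag m) → x ∪ (y ∪ z) ≡ y ∪ (x ∪ z)
  ∪-leftComm x y z = begin
    x ∪ (y ∪ z)  ≡⟨ ∪-assoc x y z ⟨
    (x ∪ y) ∪ z  ≡⟨ cong (_∪ z) (∪-comm x y) ⟩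
    (y ∪ x) ∪ z  ≡⟨ ∪-assoc y x z ⟩
    y ∪ (x ∪ z)  ∎
    where open ≡-Reasoning

  ∉-∪⁺ : ∀ {d} {x y : Bag m} → d ∉ x → d ∉ y → d ∉ (x ∪ y)
  ∉-∪⁺ {d} {x} {y} d∉x d∉y
    rewrite lookup-zipWith _+_ d x y | d∉x | d∉y = refl

  ∉-∪⁻ˡ : ∀ {d} {x y : Bag m} → d ∉ (x ∪ y) → d ∉ x
  ∉-∪⁻ˡ {d} {x} {y} d∉ = m+n≡0⇒m≡0 _ (trans (sym (lookup-zipWith _ d x y)) d∉)

  ∉-∪⁻ʳ : ∀ {d} {x y : Bag m} → d ∉ (x ∪ y) → d ∉ y
  ∉-∪⁻ʳ {d} {x} {y} d∉ =
    m+n≡0⇒n≡0 (lookup x d) (trans (sym (lookup-zipWith _ d x y)) d∉)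

  d∉⟅e⟆ : ∀ {d e : Fin m} → d ≢ e → d ∉ ⟅ e ⟆
  d∉⟅e⟆ {d} d≢e = trans (lookup∘update′ d≢e ∅ 1) (lookup-replicate d 0)

  ¬d∉⟅d⟆ : ∀ {d : Fin m} → ¬ d ∉ ⟅ d ⟆
  ¬d∉⟅d⟆ {d} d∉ = case trans (sym (lookup∘update d ∅ 1)) d∉ of λ ()

∅≢⟅⟆∪ : ∀ {m} {d : Fin m} {x} → ∅ ≢ ⟅ d ⟆ ∪ x
∅≢⟅⟆∪ {d = zero}  {_ ∷ _} ()
∅≢⟅⟆∪ {d = suc d} {_ ∷ _} eq = ∅≢⟅⟆∪ (∷-injectiveʳ eq)

⟅⟆-indecomposable : ∀ {m} {d e : Fin m} {x} → ⟅ d ⟆ ≡ ⟅ e ⟆ ∪ x → d ≡ e × x ≡ ∅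
⟅⟆-indecomposable {d = zero} {zero} {_ ∷ xs} eq with ∷-injective eq
... | 1≡1+x , ∅≡∅∪xs =
  refl , cong₂ _∷_ (sym (suc-injective 1≡1+x)) (sym (trans ∅≡∅∪xs (∪-identityˡ xs)))
⟅⟆-indecomposable {d = zero}  {suc e} {_ ∷ _} eq = ⊥-elim (∅≢⟅⟆∪ (∷-injectiveʳ eq))
⟅⟆-indecomposable {d = suc d} {zero}  {_ ∷ _} ()
⟅⟆-indecomposable {d = suc d} {suc e} {_ ∷ _} eq with ∷-injective eq
... | 0≡x , eqs with ⟅⟆-indecomposable eqs
... | d≡e , xs≡∅ = cong suc d≡e , cong₂ _∷_ (sym 0≡x) xs≡∅

-- The multiplicity of `d` in `x` decides: if positive, the copy is removed from `x`, otherwise it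
-- must come from `y`. This locates the parallel component that owns a consumed datum.
⟅⟆-prime : ∀ {m} {d : Fin m} x y {z} → x ∪ y ≡ ⟅ d ⟆ ∪ z →
           (∃[ x′ ] (x ≡ ⟅ d ⟆ ∪ x′ × z ≡ x′ ∪ y)) ⊎
           (∃[ y′ ] (y ≡ ⟅ d ⟆ ∪ y′ × z ≡ x ∪ y′))
⟅⟆-prime {d = zero} (suc a ∷ x) (b ∷ y) {c ∷ z} eq =
  inj₁ (a ∷ x , cong (suc a ∷_) (sym (∪-identityˡ x)) ,
        cong₂ _∷_ (sym (suc-injective (∷-injectiveˡ eq)))
                  (sym (trans (∷-injectiveʳ eq) (∪-identityˡ z))))
⟅⟆-prime {d = zero} (zero ∷ x) (b ∷ y) {c ∷ z} eq =
  inj₂ (c ∷ y , cong₂ _∷_ (∷-injectiveˡ eq) (sym (∪-identityˡ y)) ,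
        cong (c ∷_) (sym (trans (∷-injectiveʳ eq) (∪-identityˡ z))))
⟅⟆-prime {d = suc d} (a ∷ x) (b ∷ y) {c ∷ z} eq with ⟅⟆-prime x y (∷-injectiveʳ eq)
... | inj₁ (x′ , x≡ , z≡) = inj₁ (a ∷ x′ , cong (a ∷_) x≡ , cong₂ _∷_ (sym (∷-injectiveˡ eq)) z≡)
... | inj₂ (y′ , y≡ , z≡) = inj₂ (b ∷ y′ , cong (b ∷_) y≡ , cong₂ _∷_ (sym (∷-injectiveˡ eq)) z≡)

-- A ranking criterion for divergence preservation.

module _ {A : Set} (L : LTS A) where
  open LTS L
  open Bisimulation L

  -- Inert transitions need no answer provided that they decrease the rank.
  RankedTransfer : (State → State → Set) → (State → ℕ) → Set
  RankedTransfer R rank = ∀ {s t} → R s t → ∀ {a s′} → s —[ a ]→ s′ →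
    (∃[ t″ ] ∃[ t′ ] (t ⇒ t″ × t″ —[ a ]→ t′ × R s t″ × R s′ t′)) ⊎
    (a ≡ τ × R s′ t × rank s′ < rank s)

  ⇒-then-τ : ∀ {s s′ s″} → s ⇒ s′ → s′ —[ τ ]→ s″ → s ⇒⁺ s″
  ⇒-then-τ ε        step = [ step ]
  ⇒-then-τ (t ◅ ts) step = t ∷ ⇒-then-τ ts step

  module _ {R : State → State → Set} {rank : State → ℕ}
           (ranked : RankedTransfer R rank) where

    ranked⇒transfer : ∀ {s t} → R s t → ∀ {a s′} → s —[ a ]→ s′ →
                      ∃[ t″ ] ∃[ t′ ] (t ⇒ t″ × t″ —⟨ a ⟩→ t′ × R s t″ × R s′ t′)
    ranked⇒transfer r step with ranked r step
    ... | inj₁ (t″ , t′ , ts , t , r″ , r′) = t″ , t′ , ts , inj₁ t , r″ , r′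
    ... | inj₂ (refl , r′ , _)             = _ , _ , ε , inj₂ (refl , refl) , r , r′

    -- Unanswered steps lower the rank, so a divergence cannot consist of them alone; the first
    -- answered step supplies the required nonempty silent path.
    ranked⇒divergencePreserving : DivergencePreserving R
    ranked⇒divergencePreserving s t steps rel = go _ 0 (n<1+n _)
      where
      go : ∀ bound i → rank (s i) < bound → ∃[ t′ ] (t ⇒⁺ t′ × ∃[ j ] R (s j) t′)
      go (suc bound) i below with ranked (rel i) (steps i)
      ... | inj₁ (_ , t′ , ts , t , _ , r) = t′ , ⇒-then-τ ts t , suc i , r
      ... | inj₂ (_ , _ , smaller) = go bound (suc i) (<-≤-trans smaller (s≤s⁻¹ below))

-- Induction along guarded unfolding.

module _ {A : Set} {n : ℕ} (Γ : Specification A n) (guarded : WeaklyGuarded Γ) where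

  -- A guarded expression reaches no identifier before a prefix, and every
  -- identifier unfolds to a guarded expression, so unfolding is well-founded.
  module GuardedInduction
    (P : Expr A n → Set)
    (on-𝟎 : P 𝟎) (on-𝟏 : P 𝟏) (on-· : ∀ a p → P (a · p))
    (on-⊕ : ∀ {p q} → P p → P q → P (p ⊕ q))
    (on-∥ : ∀ {p q} → P p → P q → P (p ∥ q))
    (on-var : ∀ {X} → P (Γ X) → P (var X))
    where

    on-guarded : ∀ {p} → Guarded p → P p
    on-guarded 𝟎       = on-𝟎
    on-guarded 𝟏       = on-𝟏
    on-guarded (a · p) = on-· a p
    on-guarded (g ⊕ h) = on-⊕ (on-guarded g) (on-guarded h)
    on-guarded (g ∥ h) = on-∥ (on-guarded g) (on-guarded h)

    induction : ∀ p → P p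
    induction 𝟎       = on-𝟎
    induction 𝟏       = on-𝟏
    induction (a · p) = on-· a p
    induction (p ⊕ q) = on-⊕ (induction p) (induction q)
    induction (p ∥ q) = on-∥ (induction p) (induction q)
    induction (var X) = on-var (on-guarded (guarded X))

-- Subexpressions.

subexprs : ∀ {A n} → Expr A n → List (Expr A n)
subexprs 𝟎       = 𝟎 ∷ []
subexprs 𝟏       = 𝟏 ∷ []
subexprs (a · p) = (a · p) ∷ subexprs p
subexprs (p ⊕ q) = (p ⊕ q) ∷ subexprs p ++ subexprs q
subexprs (p ∥ q) = (p ∥ q) ∷ subexprs p ++ subexprs q
subexprs (var X) = var X ∷ []

subexprs-refl : ∀ {A n} (p : Expr A n) → p ∈ subexprs p
subexprs-refl 𝟎       = here refl
subexprs-refl 𝟏       = here refl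
subexprs-refl (a · p) = here refl
subexprs-refl (p ⊕ q) = here refl
subexprs-refl (p ∥ q) = here refl
subexprs-refl (var X) = here refl

subexprs-trans : ∀ {A n} (p : Expr A n) {q} → q ∈ subexprs p → subexprs q ⊆ subexprs p
subexprs-trans 𝟎       (here refl) = id
subexprs-trans 𝟏       (here refl) = id
subexprs-trans (a · p) (here refl) = id
subexprs-trans (a · p) (there q∈)  = there ∘ subexprs-trans p q∈
subexprs-trans (p ⊕ q) (here refl) = id
subexprs-trans (p ⊕ q) (there r∈) with ∈-++⁻ (subexprs p) r∈
... | inj₁ r∈p = there ∘ ∈-++⁺ˡ ∘ subexprs-trans p r∈p
... | inj₂ r∈q = there ∘ ∈-++⁺ʳ (subexprs p) ∘ subexprs-trans q r∈q
subexprs-trans (p ∥ q) (here refl) = id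
subexprs-trans (p ∥ q) (there r∈) with ∈-++⁻ (subexprs p) r∈
... | inj₁ r∈p = there ∘ ∈-++⁺ˡ ∘ subexprs-trans p r∈p
... | inj₂ r∈q = there ∘ ∈-++⁺ʳ (subexprs p) ∘ subexprs-trans q r∈q
subexprs-trans (var X) (here refl) = id

action : ∀ {A : Set} → Label A → List A
action τ       = []
action (act a) = a ∷ []

-- Data alphabet, and expressions as bags of data.

module Construction {A : Set} {n : ℕ} (Γ : Specification A n) (X₀ : Fin n)
                    (guarded : WeaklyGuarded Γ) where
  open Semantics Γ

  universe : List (Expr A n)
  universe = tabulate var ++ concatMap (subexprs ∘ Γ) (allFin n)

  var∈universe : ∀ X → var X ∈ universe
  var∈universe X = ∈-++⁺ˡ (∈-tabulate⁺ X)

  Γ⊆universe : ∀ X → subexprs (Γ X) ⊆ universe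
  Γ⊆universe X q∈ = ∈-++⁺ʳ (tabulate var) (∈-concatMap⁺ _ (lose (∈-allFin X) q∈))

  universe-closed : ∀ {p} → p ∈ universe → subexprs p ⊆ universe
  universe-closed p∈ q∈ with ∈-++⁻ (tabulate var) p∈
  ... | inj₁ p∈vars with ∈-tabulate⁻ p∈vars
  universe-closed p∈ (here refl) | inj₁ _ | _ , refl = p∈
  universe-closed p∈ q∈ | inj₂ p∈Γ with find (∈-concatMap⁻ (subexprs ∘ Γ) {xs = allFin n} p∈Γ)
  ... | X , _ , p∈ΓX = Γ⊆universe X (subexprs-trans (Γ X) p∈ΓX q∈)

  m : ℕ
  m = List.length universe

  -- Data are positions in `universe`, so an expression occurring twice yields two data. This avoids
  -- comparing expressions, whose labels come from an arbitrary `A`.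
  datum : Fin m → Expr A n
  datum = List.lookup universe

  accepts? : ∀ p → Dec (p ↓ᵉ)
  accepts? = GuardedInduction.induction Γ guarded (λ p → Dec (p ↓ᵉ))
    (no λ ()) (yes 𝟏↓) (λ _ _ → no λ ())
    (λ p? q? → map′ [ ⊕↓ˡ , ⊕↓ʳ ]′ (λ { (⊕↓ˡ p↓) → inj₁ p↓ ; (⊕↓ʳ q↓) → inj₂ q↓ }) (p? ⊎-dec q?))
    (λ p? q? → map′ (λ (p↓ , q↓) → ∥↓ p↓ q↓) (λ { (∥↓ p↓ q↓) → p↓ , q↓ }) (p? ×-dec q?))
    (map′ var↓ λ { (var↓ p↓) → p↓ })

  -- A bag representing an expression is not unique: a datum may itself be a
  -- parallel composition.
  data Represents : Expr A n → Bag m → Set where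
    single : ∀ d → Represents (datum d) ⟅ d ⟆
    _∥_    : ∀ {p q x y} → Represents p x → Represents q y → Represents (p ∥ q) (x ∪ y)

  represents-∈ : ∀ {p} (p∈ : p ∈ universe) → Represents p ⟅ index p∈ ⟆
  represents-∈ p∈ =
    subst (λ p → Represents p ⟅ index p∈ ⟆) (sym (lookup-index p∈)) (single (index p∈))

  -- A finite table of moves, with targets stored as bags; its finiteness is what allows the moves
  -- to become transitions of an automaton.
  record Derivatives (p : Expr A n) : Set where
    field
      moves    : List (Label A × Bag m)
      sound    : ∀ {a x} → (a , x) ∈ moves → ∃[ p′ ] (p —[ a ]→ᵉ p′ × Represents p′ x)
      complete : ∀ {a p′} → p —[ a ]→ᵉ p′ → ∃[ x ] ((a , x) ∈ moves × Represents p′ x)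

  -- The inclusion is part of the induction motive because the continuation of a prefix has to be a
  -- datum. Unfolding an identifier re-establishes it through `Γ⊆universe`.
  derivatives : ∀ p → subexprs p ⊆ universe → Derivatives p
  derivatives = GuardedInduction.induction Γ guarded
    (λ p → subexprs p ⊆ universe → Derivatives p)
    (λ _ → record { moves = [] ; sound = λ () ; complete = λ () })
    (λ _ → record { moves = [] ; sound = λ () ; complete = λ () })
    on-· (λ {p} → on-⊕ {p}) on-∥ (λ {X} → on-var {X})
    where
    on-· : ∀ a p → subexprs (a · p) ⊆ universe → Derivatives (a · p)
    on-· a p sub = record
      { moves    = (a , ⟅ index p∈ ⟆) ∷ []
      ; sound    = λ { (here refl) → p , prefix , represents-∈ p∈ }
      ; complete = λ { prefix → _ , here refl , represents-∈ p∈ }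
      }
      where
      p∈ : p ∈ universe
      p∈ = sub (there (subexprs-refl p))

    on-⊕ : ∀ {p q} → (subexprs p ⊆ universe → Derivatives p) →
           (subexprs q ⊆ universe → Derivatives q) →
           subexprs (p ⊕ q) ⊆ universe → Derivatives (p ⊕ q)
    on-⊕ {p} {q} Dp Dq sub = record
      { moves    = P.moves ++ Q.moves
      ; sound    = sound
      ; complete = complete
      }
      where
      module P = Derivatives (Dp (sub ∘ there ∘ ∈-++⁺ˡ))
      module Q = Derivatives (Dq (sub ∘ there ∘ ∈-++⁺ʳ (subexprs p)))

      sound : ∀ {a x} → (a , x) ∈ P.moves ++ Q.moves →
              ∃[ p′ ] ((p ⊕ q) —[ a ]→ᵉ p′ × Represents p′ x)
      sound a∈ with ∈-++⁻ P.moves a∈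
      ... | inj₁ a∈p = let p′ , step , r = P.sound a∈p in p′ , ⊕ˡ step , r
      ... | inj₂ a∈q = let q′ , step , r = Q.sound a∈q in q′ , ⊕ʳ step , r

      complete : ∀ {a p′} → (p ⊕ q) —[ a ]→ᵉ p′ →
                 ∃[ x ] ((a , x) ∈ P.moves ++ Q.moves × Represents p′ x)
      complete (⊕ˡ step) = let x , a∈ , r = P.complete step in x , ∈-++⁺ˡ a∈ , r
      complete (⊕ʳ step) = let x , a∈ , r = Q.complete step in x , ∈-++⁺ʳ P.moves a∈ , r

    on-∥ : ∀ {p q} → (subexprs p ⊆ universe → Derivatives p) →
           (subexprs q ⊆ universe → Derivatives q) →
           subexprs (p ∥ q) ⊆ universe → Derivatives (p ∥ q)
    on-∥ {p} {q} Dp Dq sub = record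
      { moves    = pmoves ++ qmoves
      ; sound    = sound
      ; complete = complete
      }
      where
      p⊆ : subexprs p ⊆ universe
      p⊆ = sub ∘ there ∘ ∈-++⁺ˡ
      q⊆ : subexprs q ⊆ universe
      q⊆ = sub ∘ there ∘ ∈-++⁺ʳ (subexprs p)
      module P = Derivatives (Dp p⊆)
      module Q = Derivatives (Dq q⊆)

      p∈ : p ∈ universe
      p∈ = p⊆ (subexprs-refl p)
      q∈ : q ∈ universe
      q∈ = q⊆ (subexprs-refl q)

      -- The component that does not move is put into the bag as one datum, so a parallel datum is
      -- split only when it fires.
      pmoves qmoves : List (Label A × Bag m)
      pmoves = map (λ (a , x) → a , x ∪ ⟅ index q∈ ⟆) P.moves
      qmoves = map (λ (a , y) → a , ⟅ index p∈ ⟆ ∪ y) Q.moves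

      sound : ∀ {a x} → (a , x) ∈ pmoves ++ qmoves →
              ∃[ p′ ] ((p ∥ q) —[ a ]→ᵉ p′ × Represents p′ x)
      sound a∈ with ∈-++⁻ pmoves a∈
      ... | inj₁ a∈p with ∈-map⁻ _ a∈p
      ... | _ , a∈ , refl =
        let p′ , step , r = P.sound a∈ in p′ ∥ q , ∥ˡ step , r ∥ represents-∈ q∈
      sound a∈ | inj₂ a∈q with ∈-map⁻ _ a∈q
      ... | _ , a∈ , refl =
        let q′ , step , r = Q.sound a∈ in p ∥ q′ , ∥ʳ step , represents-∈ p∈ ∥ r

      complete : ∀ {a p′} → (p ∥ q) —[ a ]→ᵉ p′ →
                 ∃[ x ] ((a , x) ∈ pmoves ++ qmoves × Represents p′ x)
      complete (∥ˡ step) =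
        let x , a∈ , r = P.complete step
        in _ , ∈-++⁺ˡ (∈-map⁺ _ a∈) , r ∥ represents-∈ q∈
      complete (∥ʳ step) =
        let y , a∈ , r = Q.complete step
        in _ , ∈-++⁺ʳ pmoves (∈-map⁺ _ a∈) , represents-∈ p∈ ∥ r

    on-var : ∀ {X} → (subexprs (Γ X) ⊆ universe → Derivatives (Γ X)) →
             subexprs (var X) ⊆ universe → Derivatives (var X)
    on-var {X} D _ = record
      { moves    = moves
      ; sound    = λ a∈ → let p′ , step , r = sound a∈ in p′ , unfold step , r
      ; complete = λ { (unfold step) → complete step }
      }
      where open Derivatives (D (Γ⊆universe X))

  module Datum (d : Fin m) =
    Derivatives (derivatives (datum d) (universe-closed (∈-lookup d)))

  -- A step of a parallel composition is a step of one component; following it down to a leaf finds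
  -- the datum `d` to consume, and the rest `y` of the bag is untouched.
  fire : ∀ {p x} → Represents p x → ∀ {a p′} → p —[ a ]→ᵉ p′ →
         ∃[ d ] ∃[ y ] ∃[ z ]
           (x ≡ ⟅ d ⟆ ∪ y × (a , z) ∈ Datum.moves d × Represents p′ (z ∪ y))
  fire (single d) step =
    let z , a∈ , r = Datum.complete d step
    in d , ∅ , z , sym (∪-identityʳ _) , a∈ , subst (Represents _) (sym (∪-identityʳ z)) r
  fire (_∥_ {y = x₂} r₁ r₂) (∥ˡ step) with fire r₁ step
  ... | d , y , z , refl , a∈ , r =
    d , y ∪ x₂ , z , ∪-assoc _ y x₂ , a∈ ,
    subst (Represents _) (∪-assoc z y x₂) (r ∥ r₂)
  fire (_∥_ {x = x₁} r₁ r₂) (∥ʳ step) with fire r₂ step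
  ... | d , y , z , refl , a∈ , r =
    d , x₁ ∪ y , z , ∪-leftComm x₁ _ y , a∈ ,
    subst (Represents _) (∪-leftComm x₁ z y) (r₁ ∥ r)

  -- Converse of `fire`: `⟅⟆-prime` selects the side of each composition that holds `d`, and at a
  -- leaf `d` can only be the leaf's own datum.
  unfire : ∀ {p x} → Represents p x → ∀ {d y a z} →
           x ≡ ⟅ d ⟆ ∪ y → (a , z) ∈ Datum.moves d →
           ∃[ p′ ] (p —[ a ]→ᵉ p′ × Represents p′ (z ∪ y))
  unfire (single e) {z = z} eq a∈ with ⟅⟆-indecomposable eq
  ... | refl , refl =
    let p′ , step , r = Datum.sound e a∈
    in p′ , step , subst (Represents p′) (sym (∪-identityʳ z)) r
  unfire (_∥_ {x = x₁} {x₂} r₁ r₂) {z = z} eq a∈ with ⟅⟆-prime x₁ x₂ eq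
  ... | inj₁ (y , x₁≡ , refl) =
    let p′ , step , r = unfire r₁ x₁≡ a∈
    in _ , ∥ˡ step , subst (Represents _) (∪-assoc z y x₂) (r ∥ r₂)
  ... | inj₂ (y , x₂≡ , refl) =
    let p′ , step , r = unfire r₂ x₂≡ a∈
    in _ , ∥ʳ step , subst (Represents _) (∪-leftComm x₁ z y) (r₁ ∥ r)

  -- Acceptance as absence of rejecting data.

  rejecting : List (Fin m)
  rejecting = filter (λ d → ¬? (accepts? (datum d))) (allFin m)

  k : ℕ
  k = List.length rejecting

  reject : Fin k → Fin m
  reject = List.lookup rejecting

  reject-rejects : ∀ i → ¬ datum (reject i) ↓ᵉ
  reject-rejects i = proj₂ (∈-filter⁻ _ {xs = allFin m} (∈-lookup i))

  accepts⇒clean : ∀ {p x} → Represents p x → p ↓ᵉ → ∀ i → reject i ∉ x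
  accepts⇒clean (single d) p↓ i =
    d∉⟅e⟆ λ eq → reject-rejects i (subst (λ e → datum e ↓ᵉ) (sym eq) p↓)
  accepts⇒clean (_∥_ {x = x} {y} r₁ r₂) (∥↓ p↓ q↓) i =
    ∉-∪⁺ {x = x} {y} (accepts⇒clean r₁ p↓ i) (accepts⇒clean r₂ q↓ i)

  -- A leaf that did not accept would itself be listed in `rejecting`, contradicting its presence in
  -- its own singleton bag.
  clean⇒accepts : ∀ {p x} → Represents p x → (∀ i → reject i ∉ x) → p ↓ᵉ
  clean⇒accepts (single d) clean with accepts? (datum d)
  ... | yes d↓ = d↓
  ... | no ¬d↓ = ⊥-elim (¬d∉⟅d⟆ {d = d} (subst (_∉ ⟅ d ⟆) (sym (lookup-index d∈)) (clean (index d∈))))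
    where
    d∈ : d ∈ rejecting
    d∈ = ∈-filter⁺ _ (∈-allFin d) ¬d↓
  clean⇒accepts (_∥_ {x = x} {y} r₁ r₂) clean =
    ∥↓ (clean⇒accepts r₁ (∉-∪⁻ˡ {x = x} {y} ∘ clean))
       (clean⇒accepts r₂ (∉-∪⁻ʳ {x = x} {y} ∘ clean))

  -- The automaton.

  -- State zero only loads the initial identifier into the empty bag; in state
  -- suc j the first j rejecting data have been found absent.
  Control : Set
  Control = Fin (suc (suc k))

  Transition : Set
  Transition = Control × Label A × Signed (Fin m) × Bag m × Control

  d₀ : Fin m
  d₀ = index (var∈universe X₀)

  -- Every transition tests some datum; absence of `d₀` is certain in the empty bag, and no
  -- transition leads back to state `zero`.
  starting : Transition
  starting = zero , τ , -ˢ d₀ , ⟅ d₀ ⟆ , suc zero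

  testing : Fin k → Transition
  testing i = suc (inject₁ i) , τ , -ˢ reject i , ∅ , suc (suc i)

  -- Enabled at every position `j` of the chain, so that testing never disables a move and stays
  -- inert. The restart is needed because `x` may contain rejecting data.
  moving : Fin (suc k) → Fin m × Label A × Bag m → Transition
  moving j (d , a , x) = suc j , a , +ˢ d , x , suc zero

  datumMoves : List (Fin m × Label A × Bag m)
  datumMoves = concatMap (λ d → map (d ,_) (Datum.moves d)) (allFin m)

  transitions : List Transition
  transitions =
    starting ∷ map testing (allFin k) ++ cartesianProductWith moving (allFin (suc k)) datumMoves

  -- A view of list membership by origin, so that later arguments match on three constructors.
  data Rule : Transition → Set where
    start : Rule starting
    test  : ∀ i → Rule (testing i)
    move  : ∀ j {d a x} → (a , x) ∈ Datum.moves d → Rule (moving j (d , a , x))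

  ∈⇒rule : ∀ {t} → t ∈ transitions → Rule t
  ∈⇒rule (here refl) = start
  ∈⇒rule (there t∈) with ∈-++⁻ (map testing (allFin k)) t∈
  ... | inj₁ t∈tests with ∈-map⁻ testing t∈tests
  ... | i , _ , refl = test i
  ∈⇒rule (there t∈) | inj₂ t∈moves
    with ∈-cartesianProductWith⁻ moving (allFin (suc k)) datumMoves t∈moves
  ... | j , _ , _ , dax∈ , refl
    with find (∈-concatMap⁻ (λ d → map (d ,_) (Datum.moves d)) {xs = allFin m} dax∈)
  ... | d , _ , ax∈ with ∈-map⁻ (d ,_) ax∈
  ... | _ , a∈ , refl = move j a∈

  rule⇒∈ : ∀ {t} → Rule t → t ∈ transitions
  rule⇒∈ start    = here refl
  rule⇒∈ (test i) = there (∈-++⁺ˡ (∈-map⁺ testing (∈-allFin i)))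
  rule⇒∈ (move j {d} a∈) =
    there (∈-++⁺ʳ (map testing (allFin k))
      (∈-cartesianProductWith⁺ moving (∈-allFin j)
        (∈-concatMap⁺ _ (lose (∈-allFin d) (∈-map⁺ (d ,_) a∈)))))

  transitionAction : Transition → List A
  transitionAction (_ , a , _) = action a

  M : PPDA A
  M = record
    { #states     = suc (suc k)
    ; #data       = m
    ; alphabet    = concatMap transitionAction transitions
    ; transitions = transitions
    ; labels⊆     = λ t∈ → ∈-concatMap⁺ transitionAction (lose t∈ (here refl))
    ; initial     = zero
    ; accepting   = ⁅ suc (fromℕ k) ⁆
    }

  open PPDA M using (Config; Step; present; absent)
  module C = LTS (ProcessGraph.lts (𝒫 M))

  -- The simulation between expressions and configurations.

  -- Distance in the control chain to the accepting state: `suc k` at the root, zero at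
  -- `suc (fromℕ k)`.
  rank : Config → ℕ
  rank (s , _) = suc k ∸ toℕ s

  data Simulates : Expr A n → Config → Set where
    initial : Simulates (var X₀) (zero , ∅)
    tested  : ∀ {p x j} → Represents p x → (∀ i → toℕ i < toℕ j → reject i ∉ x) →
              Simulates p (suc j , x)

  untested : ∀ {p x} → Represents p x → Simulates p (suc zero , x)
  untested r = tested r λ _ ()

  test-step : ∀ {x} i → reject i ∉ x → Step (suc (inject₁ i) , x) τ (suc (suc i) , x)
  test-step {x} i i∉x =
    subst (λ y → Step (suc (inject₁ i) , x) τ (suc (suc i) , y)) (∪-identityˡ x) (absent (rule⇒∈ (test i)) i∉x)

  load : Represents (var X₀) ⟅ d₀ ⟆
  load = represents-∈ (var∈universe X₀)

  start-step : Step (zero , ∅) τ (suc zero , ⟅ d₀ ⟆)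
  start-step =
    subst (λ y → Step (zero , ∅) τ (suc zero , y)) (∪-identityʳ ⟅ d₀ ⟆)
      (absent (rule⇒∈ start) (lookup-replicate d₀ 0))

  -- Induction runs backwards from the end of the chain, prepending one test at a time.
  tests : ∀ {x} → (∀ i → reject i ∉ x) → ∀ j → (suc j , x) C.⇒ (suc (fromℕ k) , x)
  tests {x} clean = >-weakInduction (λ j → (suc j , x) C.⇒ (suc (fromℕ k) , x)) ε
    (λ i rest → test-step i (clean i) ◅ rest)

  simulate-rep : ∀ {p x j} → Represents p x → ∀ {a p′} → p —[ a ]→ᵉ p′ →
                 ∃[ c′ ] (Step (suc j , x) a c′ × Simulates p′ c′)
  simulate-rep {j = j} r step with fire r step
  ... | d , y , z , refl , a∈ , r′ = _ , present (rule⇒∈ (move j a∈)) , untested r′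

  simulate : ∀ {p c} → Simulates p c → ∀ {a p′} → p —[ a ]→ᵉ p′ →
             ∃[ c″ ] ∃[ c′ ] (c C.⇒ c″ × Step c″ a c′ × Simulates p c″ × Simulates p′ c′)
  simulate initial step =
    let c′ , cstep , sim = simulate-rep load step
    in _ , c′ , start-step ◅ ε , cstep , untested load , sim
  simulate (tested r clean) step =
    let c′ , cstep , sim = simulate-rep r step
    in _ , c′ , ε , cstep , tested r clean , sim

  simulate-accept : ∀ {p c} → Simulates p c → p ↓ᵉ → ∃[ c′ ] (c C.⇒ c′ × c′ C.↓)
  simulate-accept initial p↓ =
    _ , start-step ◅ tests (accepts⇒clean load p↓) zero , x∈⁅x⁆ _
  simulate-accept (tested {j = j} r _) p↓ = _ , tests (accepts⇒clean r p↓) j , x∈⁅x⁆ _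

  reflect-absent : ∀ {p s a d z t x} → Simulates p (s , x) →
                   Rule (s , a , -ˢ d , z , t) → d ∉ x →
                   a ≡ τ × Simulates p (t , z ∪ x) × rank (t , z ∪ x) < rank (s , x)
  reflect-absent initial start _ =
    refl , subst (λ x → Simulates _ (suc zero , x)) (sym (∪-identityʳ _)) (untested load) , n<1+n k
  reflect-absent {x = x} (tested r clean) (test i) i∉x =
    refl ,
    subst (λ x → Simulates _ (suc (suc i) , x)) (sym (∪-identityˡ x)) (tested r clean′) ,
    -- The bound `toℕ<n i` keeps the truncated subtraction from bottoming out, so the decrease is
    -- strict.
    ∸-monoʳ-< (s≤s (≤-reflexive (cong suc (toℕ-inject₁ i)))) (s≤s (toℕ<n i))
    where
    clean′ : ∀ j → toℕ j < suc (toℕ i) → reject j ∉ x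
    clean′ j j≤i with m≤n⇒m<n∨m≡n (s≤s⁻¹ j≤i)
    ... | inj₁ j<i = clean j (<-≤-trans j<i (≤-reflexive (sym (toℕ-inject₁ i))))
    ... | inj₂ j≡i = subst (λ i → reject i ∉ x) (sym (toℕ-injective j≡i)) i∉x

  -- Only `move` consumes a datum, and it leaves a state `suc j`, which rules out `initial`.
  reflect-present : ∀ {p s a d z t x} → Simulates p (s , ⟅ d ⟆ ∪ x) →
                    Rule (s , a , +ˢ d , z , t) →
                    ∃[ p′ ] (p —[ a ]→ᵉ p′ × Simulates p′ (t , z ∪ x))
  reflect-present (tested r _) (move _ a∈) =
    let p′ , step , r′ = unfire r refl a∈ in p′ , step , untested r′

  reflect : ∀ {p c} → Simulates p c → ∀ {a c′} → Step c a c′ →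
            (∃[ p′ ] (p —[ a ]→ᵉ p′ × Simulates p′ c′)) ⊎
            (a ≡ τ × Simulates p c′ × rank c′ < rank c)
  reflect sim (present t∈)    = inj₁ (reflect-present sim (∈⇒rule t∈))
  reflect sim (absent t∈ d∉x) = inj₂ (reflect-absent sim (∈⇒rule t∈) d∉x)

  -- At the end of the chain the invariant of `tested` covers all `k` rejecting data.
  reflect-accept : ∀ {p c} → Simulates p c → c C.↓ → p ↓ᵉ
  reflect-accept initial c↓ = case x∈⁅y⁆⇒x≡y (suc (fromℕ k)) c↓ of λ ()
  reflect-accept (tested r clean) c↓ with x∈⁅y⁆⇒x≡y (suc (fromℕ k)) c↓
  ... | refl = clean⇒accepts r λ i →
    clean i (<-≤-trans (toℕ<n i) (≤-reflexive (sym (toℕ-fromℕ k))))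

  -- The bisimulation on the disjoint union.

  union : LTS A
  union = ProcessGraph.lts (processGraph Γ X₀) ⊎ˡ ProcessGraph.lts (𝒫 M)
  module U = LTS union

  data _≈_ : U.State → U.State → Set where
    forth : ∀ {p c} → Simulates p c → inj₁ p ≈ inj₂ c
    back  : ∀ {p c} → Simulates p c → inj₂ c ≈ inj₁ p

  -- Expressions may all have rank zero: each of their steps is answered by a genuine step of the
  -- automaton.
  rankᵁ : U.State → ℕ
  rankᵁ (inj₁ _) = 0
  rankᵁ (inj₂ c) = rank c

  inj₂-⇒ : ∀ {c c′} → c C.⇒ c′ → inj₂ c U.⇒ inj₂ c′
  inj₂-⇒ = gmap inj₂ inj₂

  ≈-ranked : RankedTransfer union _≈_ rankᵁ
  ≈-ranked (forth sim) (inj₁ step) =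
    let c″ , c′ , cs , cstep , sim″ , sim′ = simulate sim step
    in inj₁ (_ , _ , inj₂-⇒ cs , inj₂ cstep , forth sim″ , forth sim′)
  ≈-ranked (back sim) (inj₂ step) with reflect sim step
  ... | inj₁ (p′ , pstep , sim′)    = inj₁ (_ , _ , ε , inj₁ pstep , back sim , back sim′)
  ... | inj₂ (a≡τ , sim′ , smaller) = inj₂ (a≡τ , back sim′ , smaller)

  open Bisimulation union

  ≈-bisimulation : IsBranchingBisimulation _≈_
  ≈-bisimulation = record
    { symmetric = λ { (forth sim) → back sim ; (back sim) → forth sim }
    ; transfer  = ranked⇒transfer union ≈-ranked
    ; accept    = λ
      { (forth sim) p↓ → let _ , cs , c↓ = simulate-accept sim p↓ in _ , inj₂-⇒ cs , c↓
      ; (back sim) c↓ → _ , ε , reflect-accept sim c↓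
      }
    }

  bisimilar : Bisimilar (inj₁ (var X₀)) (inj₂ (zero , ∅))
  bisimilar =
    _≈_ , ≈-bisimulation , ranked⇒divergencePreserving union ≈-ranked , forth initial

theorem5 : ∀ {A : Set} {n : ℕ} (Γ : Specification A n) (X₀ : Fin n) →
    WeaklyGuarded Γ →
    ∃[ M ] (processGraph Γ X₀ ≈ᵇΔ 𝒫 M)
theorem5 Γ X₀ guarded = M , bisimilar
  where open Construction Γ X₀ guarded
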